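{- For integers $1\leq k\leq n$, let $\hat{B}_{k,n}$ be the set of all $(x_1,\ldots,x_n)\in[0,1]^n$ with $x_{i+1}+\cdots+x_{i+k}\leq1$ for all $0\leq i\leq n-k$. Then the Ehrhart $h^*$-polynomial $E^*(\hat{B}_{k,n},z)$ is palindromic, i.e. writing it as $\sum_{h=0}^d a_hz^h$ with $d$ its degree, $a_h=a_{d-h}$ for all $0\leq h\leq d$.
   Context: For a lattice polytope $P\subset\mathbb{R}^n$, $E(P,t)=\#(tP\cap\mathbb{Z}^n)$ for integers $t\geq0$ and $E^*(P,z)=(1-z)^{n+1}\sum_{t\geq0}E(P,t)z^t$, which is a polynomial. ($\hat{B}_{k,n}$ is a lattice polytope.) -}

module Defs where

open import Data.Nat as ℕ using (ℕ; zero; suc; _∸_; _≤_; _≤?_)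
open import Data.Nat.Combinatorics using (_C_)
open import Data.Integer as ℤ using (ℤ; +_)
open import Data.List using (List; []; _∷_; map; concatMap; upTo; length; filter; take; drop; foldr)
open import Data.Nat.ListAction using (sum)
open import Relation.Nullary using (Dec)
open import Data.List.Relation.Unary.All using (All; all?)

box : ℕ → ℕ → List (List ℕ)
box t zero    = [] ∷ []
box t (suc n) = concatMap (λ a → map (a ∷_) (box t n)) (upTo (suc t))

InDilate : ℕ → ℕ → ℕ → List ℕ → Set
InDilate k n t x = All (λ i → sum (take k (drop i x)) ≤ t) (upTo (suc (n ∸ k)))

inDilate? : ∀ k n t x → Dec (InDilate k n t x)
inDilate? k n t x = all? (λ i → sum (take k (drop i x)) ≤? t) (upTo (suc (n ∸ k)))

-- Ehrhart function E(B̂_{k,n}, t) = #(t·B̂_{k,n} ∩ ℤ^n).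
-- (Since B̂_{k,n} ⊆ [0,1]^n, every lattice point of t·B̂ lies in [0,t]^n.)
ehrhart : ℕ → ℕ → ℕ → ℕ
ehrhart k n t = length (filter (inDilate? k n t) (box t n))

sign : ℕ → ℤ
sign zero    = + 1
sign (suc j) = ℤ.- sign j

-- Coefficient of z^h in (1-z)^{n+1} · Σ_{t≥0} E(B̂_{k,n},t) z^t, i.e. the h-th
-- coefficient of the h*-polynomial E*(B̂_{k,n}, z):
--   Σ_{j=0}^{h} (-1)^j C(n+1,j) E(B̂_{k,n}, h-j).
hstar : ℕ → ℕ → ℕ → ℤ
hstar k n h =
  foldr ℤ._+_ (+ 0)
    (map (λ j → sign j ℤ.* (+ ((suc n) C j)) ℤ.* (+ ehrhart k n (h ∸ j))) (upTo (suc h)))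

{-# OPTIONS --safe #-}

-- Prepending one coordinate x at a time, the lattice points of sB are counted by
--   F₀ = 1,  Fₙ₊₁(s; y) = Σ_{0 ≤ x ≤ s − (y₁ + ⋯ + yₖ₋₁)} Fₙ(s; x, y).
-- Continuing such sums to negative upper bounds defines Fₙ on all integers, as a
-- polynomial function of degree at most n, and x ↦ −1 − x in each sum gives
--   Fₙ(−s−k−1; −1−y) = (−1)ⁿ Fₙ(s; y).
-- At y = 0 with s ≥ 0, and at y = (−1, …, −1) with s ≥ −k, Fₙ(s; y) is the number of
-- lattice points of sB, which is 0 for s < 0. So, with e the Ehrhart function extended
-- by 0 to negative arguments,
--   e(m) + (−1)ⁿ e(−m−k−1)
-- is a polynomial in m, killed by the (n+1)-st difference, which sends e to the
-- coefficients of h*. This reads h*(m) = h*(n−k−m) for every integer m, whence the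
-- degree n − k and the palindromicity.
module Submission where

open import Defs
open import Data.Nat using (ℕ; _≤_; _<_; _∸_)
open import Data.Integer using (+_)
open import Relation.Binary.PropositionalEquality using (_≡_; _≢_)
open import Data.Nat as ℕ using (zero; suc; z≤n; s≤s)
open import Data.Integer as ℤ using (ℤ; -[1+_]; 0ℤ; 1ℤ; -1ℤ; +≤+; -≤+)
open import Data.Integer.Tactic.RingSolver using (solve-∀)
open import Data.List using (List; []; _∷_; _++_; _∷ʳ_; map; length; replicate; foldr; filter; take; drop; applyUpTo; concatMap)
open import Data.Nat.Combinatorics using (_C_; k>n⇒nCk≡0; nCk+nC[k+1]≡[n+1]C[k+1])
open import Relation.Binary.PropositionalEquality using (refl; sym; trans; cong; cong₂; subst; module ≡-Reasoning)
import Data.Integer.Properties as ℤₚ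
open import Algebra.Properties.AbelianGroup ℤₚ.+-0-abelianGroup using (∙-cancelʳ)
import Data.Nat.Properties as ℕₚ
open import Data.List.Properties using (map-replicate; length-replicate; take-all)
open import Data.List.Relation.Unary.All using (All; []; _∷_)
import Data.List.Relation.Unary.All.Properties as Allₚ
open import Data.Nat.ListAction using (sum)
open import Data.Product using (_×_; _,_; proj₁; proj₂)
open import Data.Unit using (⊤; tt)
open import Relation.Nullary using (¬_; Dec; yes; no; contradiction)
open import Relation.Nullary.Decidable using (_×-dec_)
open import Relation.Unary using (Decidable)
open import Relation.Binary.Definitions using (tri<; tri≈; tri>)

-- Finite sums and their continuation to negative upper bounds.

Sum : ℕ → (ℕ → ℤ) → ℤ
Sum zero    f = 0ℤ
Sum (suc n) f = f 0 ℤ.+ Sum n (λ i → f (suc i))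

Sum-cong : ∀ n {f g} → (∀ i → f i ≡ g i) → Sum n f ≡ Sum n g
Sum-cong zero    e = refl
Sum-cong (suc n) e = cong₂ ℤ._+_ (e 0) (Sum-cong n (λ i → e (suc i)))

Sum-+ : ∀ n f g → Sum n (λ i → f i ℤ.+ g i) ≡ Sum n f ℤ.+ Sum n g
Sum-+ zero    f g = refl
Sum-+ (suc n) f g
  rewrite Sum-+ n (λ i → f (suc i)) (λ i → g (suc i)) = lemma (f 0) (g 0) _ _
  where
  lemma : ∀ a b c d → (a ℤ.+ b) ℤ.+ (c ℤ.+ d) ≡ (a ℤ.+ c) ℤ.+ (b ℤ.+ d)
  lemma = solve-∀

Sum-* : ∀ n c f → Sum n (λ i → c ℤ.* f i) ≡ c ℤ.* Sum n f
Sum-* zero    c f = sym (ℤₚ.*-zeroʳ c)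
Sum-* (suc n) c f rewrite Sum-* n c (λ i → f (suc i)) = sym (ℤₚ.*-distribˡ-+ c _ _)

Sum-zero : ∀ n {f} → (∀ i → f i ≡ 0ℤ) → Sum n f ≡ 0ℤ
Sum-zero zero    e = refl
Sum-zero (suc n) e rewrite e 0 | Sum-zero n (λ i → e (suc i)) = refl

Sum-last : ∀ n f → Sum (suc n) f ≡ Sum n f ℤ.+ f n
Sum-last zero    f = ℤₚ.+-comm (f 0) 0ℤ
Sum-last (suc n) f
  rewrite Sum-last n (λ i → f (suc i)) = sym (ℤₚ.+-assoc (f 0) _ _)

Sum-swap : ∀ m n (f : ℕ → ℕ → ℤ) →
  Sum m (λ i → Sum n (f i)) ≡ Sum n (λ j → Sum m (λ i → f i j))
Sum-swap zero    n f = sym (Sum-zero n (λ _ → refl))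
Sum-swap (suc m) n f
  rewrite Sum-swap m n (λ i → f (suc i)) = sym (Sum-+ n (f 0) _)

Sum-truncate : ∀ {p q f g} → p ≤ q → (∀ i → i < p → g i ≡ f i) →
  (∀ i → p ≤ i → g i ≡ 0ℤ) → Sum q g ≡ Sum p f
Sum-truncate {q = q} z≤n on off = Sum-zero q (λ i → off i z≤n)
Sum-truncate (s≤s p≤q) on off = cong₂ ℤ._+_ (on 0 (s≤s z≤n))
  (Sum-truncate p≤q (λ i i<p → on (suc i) (s≤s i<p)) (λ i p≤i → off (suc i) (s≤s p≤i)))

-- The sum of f over 0 ≤ x < m, continued to negative m by S f (1 + m) = S f m + f m.
S : (ℤ → ℤ) → ℤ → ℤ
S f (+ m)    = Sum m (λ i → f (+ i))
S f -[1+ m ] = ℤ.- Sum (suc m) (λ i → f -[1+ i ])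

S-cong : ∀ {f g} → (∀ x → f x ≡ g x) → ∀ m → S f m ≡ S g m
S-cong e (+ m)    = Sum-cong m (λ i → e (+ i))
S-cong e -[1+ m ] = cong ℤ.-_ (Sum-cong (suc m) (λ i → e -[1+ i ]))

S-* : ∀ c f m → S (λ x → c ℤ.* f x) m ≡ c ℤ.* S f m
S-* c f (+ m)    = Sum-* m c _
S-* c f -[1+ m ] = trans (cong ℤ.-_ (Sum-* (suc m) c g)) (ℤₚ.neg-distribʳ-* c (Sum (suc m) g))
  where
  g : ℕ → ℤ
  g i = f -[1+ i ]

S-+ : ∀ f g m → S (λ x → f x ℤ.+ g x) m ≡ S f m ℤ.+ S g m
S-+ f g (+ m)    = Sum-+ m _ _
S-+ f g -[1+ m ] = trans (cong ℤ.-_ (Sum-+ (suc m) f′ g′))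
  (ℤₚ.neg-distrib-+ (Sum (suc m) f′) (Sum (suc m) g′))
  where
  f′ g′ : ℕ → ℤ
  f′ i = f -[1+ i ]
  g′ i = g -[1+ i ]

S-zero : ∀ {f} → (∀ x → f x ≡ 0ℤ) → ∀ m → S f m ≡ 0ℤ
S-zero e (+ m)    = Sum-zero m (λ i → e (+ i))
S-zero e -[1+ m ] = cong ℤ.-_ (Sum-zero (suc m) (λ i → e -[1+ i ]))

S-neg : ∀ f m → S (λ x → ℤ.- f x) m ≡ ℤ.- S f m
S-neg f m = trans (S-cong (λ x → sym (ℤₚ.-1*i≡-i (f x))) m) (trans (S-* -1ℤ f m) (ℤₚ.-1*i≡-i _))

S-suc : ∀ f m → S f (1ℤ ℤ.+ m) ≡ S f m ℤ.+ f m
S-suc f (+ m) = Sum-last m _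
S-suc f -[1+ zero ] = lemma (f -1ℤ)
  where
  lemma : ∀ a → 0ℤ ≡ ℤ.- (a ℤ.+ 0ℤ) ℤ.+ a
  lemma = solve-∀
S-suc f -[1+ suc m ] rewrite Sum-last (suc m) (λ i → f -[1+ i ]) = lemma _ _
  where
  lemma : ∀ a b → ℤ.- a ≡ ℤ.- (a ℤ.+ b) ℤ.+ b
  lemma = solve-∀

-- Both sides obey the recursion `S-suc` in b and agree at b = 0. Induction runs in both directions;
-- the downward step cancels `g b`.
S-split : ∀ f a b → S f (a ℤ.+ b) ≡ S f a ℤ.+ S (λ x → f (a ℤ.+ x)) b
S-split f a = go
  where
  g : ℤ → ℤ
  g x = f (a ℤ.+ x)

  Split : ℤ → Set
  Split b = S f (a ℤ.+ b) ≡ S f a ℤ.+ S g b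

  step : ∀ b → S f (a ℤ.+ (1ℤ ℤ.+ b)) ≡ S f (a ℤ.+ b) ℤ.+ g b
  step b = trans (cong (S f) (lemma a b)) (S-suc f (a ℤ.+ b))
    where
    lemma : ∀ a b → a ℤ.+ (1ℤ ℤ.+ b) ≡ 1ℤ ℤ.+ (a ℤ.+ b)
    lemma = solve-∀

  up : ∀ b → Split b → Split (1ℤ ℤ.+ b)
  up b p rewrite step b | S-suc g b | p = ℤₚ.+-assoc (S f a) _ _

  down : ∀ b → Split (1ℤ ℤ.+ b) → Split b
  down b p = ∙-cancelʳ (g b) _ _ (trans (sym (step b)) (trans p
    (trans (cong (λ z → S f a ℤ.+ z) (S-suc g b)) (sym (ℤₚ.+-assoc (S f a) _ _)))))

  go : ∀ b → Split b
  go (+ zero) = trans (cong (S f) (ℤₚ.+-identityʳ a)) (sym (ℤₚ.+-identityʳ _))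
  go (+ suc b) = up (+ b) (go (+ b))
  go -[1+ zero ] = down -[1+ zero ] (go 0ℤ)
  go -[1+ suc b ] = down -[1+ suc b ] (go -[1+ b ])

-- The map x ↦ -1 - x, given by cases so that it exchanges the ranges in the two clauses of `S`.
reflect : ℤ → ℤ
reflect (+ n)    = -[1+ n ]
reflect -[1+ n ] = + n

S-reflect : ∀ f m → S f (ℤ.- m) ≡ ℤ.- S (λ x → f (reflect x)) m
S-reflect f (+ zero)  = refl
S-reflect f (+ suc m) = refl
S-reflect f -[1+ m ]  = sym (ℤₚ.neg-involutive _)

reflect≡ : ∀ x → reflect x ≡ -1ℤ ℤ.- x
reflect≡ (+ zero)  = refl
reflect≡ (+ suc n) = refl
reflect≡ -[1+ n ]  = refl

-- Prefix sums and entrywise addition of lists.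

prefixSum : ℕ → List ℤ → ℤ
prefixSum zero    y       = 0ℤ
prefixSum (suc κ) []      = 0ℤ
prefixSum (suc κ) (a ∷ y) = a ℤ.+ prefixSum κ y

-- Entries past the end read as 0 and are not moved by `map reflect`, hence the length bound.
prefixSum-reflect : ∀ j y → j ≤ length y →
  prefixSum j (map reflect y) ≡ ℤ.- (+ j) ℤ.- prefixSum j y
prefixSum-reflect zero    y       _ = refl
prefixSum-reflect (suc j) (a ∷ y) (s≤s j≤) rewrite reflect≡ a | prefixSum-reflect j y j≤ =
  lemma a (+ j) (prefixSum j y)
  where
  lemma : ∀ a j p → -1ℤ ℤ.- a ℤ.+ (ℤ.- j ℤ.- p) ≡ ℤ.- (1ℤ ℤ.+ j) ℤ.- (a ℤ.+ p)
  lemma = solve-∀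

-- Padding with zeros, as in `prefixSum`, allows directions of any length and makes `[]` neutral.
_⊕_ : List ℤ → List ℤ → List ℤ
y       ⊕ []      = y
[]      ⊕ (b ∷ z) = b ∷ z
(a ∷ y) ⊕ (b ∷ z) = (a ℤ.+ b) ∷ (y ⊕ z)

prefixSum-⊕ : ∀ κ y z → prefixSum κ (y ⊕ z) ≡ prefixSum κ y ℤ.+ prefixSum κ z
prefixSum-⊕ zero    y       z       = refl
prefixSum-⊕ (suc κ) y       []      = sym (ℤₚ.+-identityʳ _)
prefixSum-⊕ (suc κ) []      (b ∷ z) = sym (ℤₚ.+-identityˡ _)
prefixSum-⊕ (suc κ) (a ∷ y) (b ∷ z) rewrite prefixSum-⊕ κ y z = lemma a b _ _
  where
  lemma : ∀ a b c d → a ℤ.+ b ℤ.+ (c ℤ.+ d) ≡ a ℤ.+ c ℤ.+ (b ℤ.+ d)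
  lemma = solve-∀

⊕-exchange : ∀ y z w → (y ⊕ z) ⊕ w ≡ (y ⊕ w) ⊕ z
⊕-exchange y       []      w       = refl
⊕-exchange y       (b ∷ z) []      = refl
⊕-exchange []      (b ∷ z) (c ∷ w) = cong₂ _∷_ (ℤₚ.+-comm b c) (comm z w)
  where
  comm : ∀ z w → z ⊕ w ≡ w ⊕ z
  comm []      []      = refl
  comm []      (c ∷ w) = refl
  comm (b ∷ z) []      = refl
  comm (b ∷ z) (c ∷ w) = cong₂ _∷_ (ℤₚ.+-comm b c) (comm z w)
⊕-exchange (a ∷ y) (b ∷ z) (c ∷ w) = cong₂ _∷_ (lemma a b c) (⊕-exchange y z w)
  where
  lemma : ∀ a b c → a ℤ.+ b ℤ.+ c ≡ a ℤ.+ c ℤ.+ b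
  lemma = solve-∀

-- Polynomial functions, by finite differences.

diff : (ℤ → List ℤ → ℤ) → ℤ → List ℤ → ℤ → List ℤ → ℤ
diff f τ η t y = f t y ℤ.- f (t ℤ.+ τ) (y ⊕ η)

-- f is a polynomial function of total degree < d: all its d-fold differences vanish.
Poly : ℕ → (ℤ → List ℤ → ℤ) → Set
Poly zero    f = ∀ t y → f t y ≡ 0ℤ
Poly (suc d) f = ∀ τ η → Poly d (diff f τ η)

Poly-cong : ∀ d {f g} → (∀ t y → f t y ≡ g t y) → Poly d f → Poly d g
Poly-cong zero    e p t y = trans (sym (e t y)) (p t y)
Poly-cong (suc d) e p τ η =
  Poly-cong d (λ t y → cong₂ ℤ._-_ (e t y) (e (t ℤ.+ τ) (y ⊕ η))) (p τ η)

Poly-zero : ∀ d → Poly d (λ _ _ → 0ℤ)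
Poly-zero zero    t y = refl
Poly-zero (suc d) τ η = Poly-zero d

Poly-+ : ∀ d {f g} → Poly d f → Poly d g → Poly d (λ t y → f t y ℤ.+ g t y)
Poly-+ zero    p q t y rewrite p t y | q t y = refl
Poly-+ (suc d) {f} {g} p q τ η =
  Poly-cong d (λ t y → lemma (f t y) _ (g t y) _) (Poly-+ d (p τ η) (q τ η))
  where
  lemma : ∀ a b c d → (a ℤ.- b) ℤ.+ (c ℤ.- d) ≡ (a ℤ.+ c) ℤ.- (b ℤ.+ d)
  lemma = solve-∀

Poly-neg : ∀ d {f} → Poly d f → Poly d (λ t y → ℤ.- f t y)
Poly-neg zero    p t y rewrite p t y = refl
Poly-neg (suc d) {f} p τ η = Poly-cong d (λ t y → lemma (f t y) _) (Poly-neg d (p τ η))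
  where
  lemma : ∀ a b → ℤ.- (a ℤ.- b) ≡ (ℤ.- a) ℤ.- (ℤ.- b)
  lemma = solve-∀

Poly-Sum : ∀ d n {f : ℕ → ℤ → List ℤ → ℤ} → (∀ i → Poly d (f i)) →
  Poly d (λ t y → Sum n (λ i → f i t y))
Poly-Sum d zero    p = Poly-zero d
Poly-Sum d (suc n) p = Poly-+ d (p 0) (Poly-Sum d n (λ i → p (suc i)))

Poly-S : ∀ d m {f : ℤ → ℤ → List ℤ → ℤ} → (∀ x → Poly d (f x)) →
  Poly d (λ t y → S (λ x → f x t y) m)
Poly-S d (+ m)    p = Poly-Sum d m (λ i → p (+ i))
Poly-S d -[1+ m ] p = Poly-neg d (Poly-Sum d (suc m) (λ i → p -[1+ i ]))

-- The counting polynomial: degree bound and reciprocity.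

module _ (κ : ℕ) where

  -- When nonnegative, the number of naturals x with x + `prefixSum κ y` ≤ s.
  slack : ℤ → List ℤ → ℤ
  slack s y = 1ℤ ℤ.+ s ℤ.- prefixSum κ y

  slack-⊕ : ∀ t y τ η →
    slack (t ℤ.+ τ) (y ⊕ η) ≡ slack t y ℤ.+ (τ ℤ.- prefixSum κ η)
  slack-⊕ t y τ η rewrite prefixSum-⊕ κ y η = lemma t τ _ _
    where
    lemma : ∀ t τ a b → 1ℤ ℤ.+ (t ℤ.+ τ) ℤ.- (a ℤ.+ b) ≡ 1ℤ ℤ.+ t ℤ.- a ℤ.+ (τ ℤ.- b)
    lemma = solve-∀

  -- The substitution is affine: a difference of the composite is the composite of a difference of
  -- f, in the image direction, whose head is the change of `slack`.
  Poly-subst : ∀ d {f} τ η x → Poly d f →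
    Poly d (λ t y → f (t ℤ.+ τ) ((slack t y ℤ.+ x) ∷ (y ⊕ η)))
  Poly-subst zero    τ η x p t y = p _ _
  Poly-subst (suc d) {f} τ η x p τ′ η′ =
    Poly-cong d (λ t y → cong (ℤ._-_ (f (t ℤ.+ τ) ((slack t y ℤ.+ x) ∷ (y ⊕ η)))) (eq t y))
      (Poly-subst d τ η x (p τ′ ((τ′ ℤ.- prefixSum κ η′) ∷ η′)))
    where
    lemma : ∀ a b c → a ℤ.+ b ℤ.+ c ≡ a ℤ.+ c ℤ.+ b
    lemma = solve-∀
    eq : ∀ t y →
      f (t ℤ.+ τ ℤ.+ τ′) ((slack t y ℤ.+ x ℤ.+ (τ′ ℤ.- prefixSum κ η′)) ∷ ((y ⊕ η) ⊕ η′)) ≡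
      f (t ℤ.+ τ′ ℤ.+ τ) ((slack (t ℤ.+ τ′) (y ⊕ η′) ℤ.+ x) ∷ ((y ⊕ η′) ⊕ η))
    eq t y rewrite slack-⊕ t y τ′ η′ =
      cong₂ f (lemma t τ τ′) (cong₂ _∷_ (lemma (slack t y) x _) (⊕-exchange y η η′))

  sumHead : (ℤ → List ℤ → ℤ) → ℤ → List ℤ → ℤ
  sumHead f s y = S (λ x → f s (x ∷ y)) (slack s y)

  -- A difference of sumHead f is sumHead of a difference of f, plus a sum
  -- of fixed length of affine substitution instances of f.
  Poly-sumHead : ∀ d f → Poly d f → Poly (suc d) (sumHead f)
  Poly-sumHead zero f p = Poly-cong 1 (λ t y → sym (S-zero (λ x → p t (x ∷ y)) (slack t y))) (Poly-zero 1)
  Poly-sumHead (suc d) f p τ η =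
    Poly-cong (suc d) eq
      -- The head 0 of the direction keeps the summation variable fixed.
      (Poly-+ (suc d) {f = sumHead (diff f τ (0ℤ ∷ η))}
        (Poly-sumHead d (diff f τ (0ℤ ∷ η)) (p τ (0ℤ ∷ η)))
        (Poly-S (suc d) δ {f = λ x t y → ℤ.- shifted x t y}
          (λ x → Poly-neg (suc d) {f = shifted x} (Poly-subst (suc d) {f} τ η x p))))
    where
    shifted : ℤ → ℤ → List ℤ → ℤ
    shifted x t y = f (t ℤ.+ τ) ((slack t y ℤ.+ x) ∷ (y ⊕ η))
    δ : ℤ
    δ = τ ℤ.- prefixSum κ η
    lemma : ∀ a b c → a ℤ.+ ℤ.- b ℤ.+ ℤ.- c ≡ a ℤ.- (b ℤ.+ c)
    lemma = solve-∀
    eq : ∀ t y →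
      sumHead (diff f τ (0ℤ ∷ η)) t y ℤ.+
        S (λ x → ℤ.- f (t ℤ.+ τ) ((slack t y ℤ.+ x) ∷ (y ⊕ η))) δ
      ≡ diff (sumHead f) τ η t y
    eq t y = begin
      S (λ x → f t (x ∷ y) ℤ.- f t′ ((x ℤ.+ 0ℤ) ∷ y′)) m ℤ.+ S (λ x → ℤ.- f t′ ((m ℤ.+ x) ∷ y′)) δ
        ≡⟨ cong₂ ℤ._+_ (S-cong (λ x → cong (λ z → f t (x ∷ y) ℤ.- f t′ (z ∷ y′)) (ℤₚ.+-identityʳ x)) m)
             (S-neg (λ x → f t′ ((m ℤ.+ x) ∷ y′)) δ) ⟩
      S (λ x → f t (x ∷ y) ℤ.- h x) m ℤ.- S (λ x → h (m ℤ.+ x)) δ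
        ≡⟨ cong (λ z → z ℤ.- S (λ x → h (m ℤ.+ x)) δ)
             (trans (S-+ (λ x → f t (x ∷ y)) (λ x → ℤ.- h x) m)
                    (cong (ℤ._+_ (S (λ x → f t (x ∷ y)) m)) (S-neg h m))) ⟩
      S (λ x → f t (x ∷ y)) m ℤ.- S h m ℤ.- S (λ x → h (m ℤ.+ x)) δ
        ≡⟨ lemma (S (λ x → f t (x ∷ y)) m) (S h m) _ ⟩
      S (λ x → f t (x ∷ y)) m ℤ.- (S h m ℤ.+ S (λ x → h (m ℤ.+ x)) δ)
        -- The range changes from m to m + δ; `S-split` cuts it at m for either sign of δ.
        ≡⟨ cong (ℤ._-_ (S (λ x → f t (x ∷ y)) m))
             (trans (sym (S-split h m δ)) (cong (S h) (sym (slack-⊕ t y τ η)))) ⟩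
      diff (sumHead f) τ η t y ∎
      where
      open ≡-Reasoning
      m t′ : ℤ
      m = slack t y
      t′ = t ℤ.+ τ
      y′ : List ℤ
      y′ = y ⊕ η
      h : ℤ → ℤ
      h x = f t′ (x ∷ y′)

  -- For admissible arguments, F n s y counts the ways of prepending n naturals to y
  -- so that every new window of 1 + κ consecutive entries has sum at most s.
  F : ℕ → ℤ → List ℤ → ℤ
  F zero    = λ _ _ → 1ℤ
  F (suc n) = sumHead (F n)

  Poly-F : ∀ n → Poly (suc n) (F n)
  Poly-F zero    τ η t y = refl
  Poly-F (suc n) = Poly-sumHead (suc n) (F n) (Poly-F n)

  -- This determines the constant -k-1 = -κ-2: reflecting κ entries accounts for -κ, and -2 turns
  -- the 1 in `slack` into -1.
  slack-reflect : ∀ s y → κ ≤ length y →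
    slack (-[1+ suc κ ] ℤ.- s) (map reflect y) ≡ ℤ.- slack s y
  slack-reflect s y κ≤ rewrite prefixSum-reflect κ y κ≤ = lemma s (+ κ) (prefixSum κ y)
    where
    lemma : ∀ s j p → 1ℤ ℤ.+ (ℤ.- (+ 2 ℤ.+ j) ℤ.- s) ℤ.- (ℤ.- j ℤ.- p) ≡ ℤ.- (1ℤ ℤ.+ s ℤ.- p)
    lemma = solve-∀

  -- Reciprocity: reflecting every summation range turns the count for dilation s into
  -- the one for dilation -s-k-1, where k = 1 + κ.
  F-reflect : ∀ n s y → κ ≤ length y →
    F n (-[1+ suc κ ] ℤ.- s) (map reflect y) ≡ sign n ℤ.* F n s y
  F-reflect zero    s y _  = refl
  F-reflect (suc n) s y κ≤ = begin
    S (λ x → F n s′ (x ∷ y′)) (slack s′ y′)       ≡⟨ cong (S (λ x → F n s′ (x ∷ y′))) (slack-reflect s y κ≤) ⟩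
    S (λ x → F n s′ (x ∷ y′)) (ℤ.- m)             ≡⟨ S-reflect _ m ⟩
    ℤ.- S (λ x → F n s′ (reflect x ∷ y′)) m         ≡⟨ cong ℤ.-_ (S-cong (λ x → F-reflect n s (x ∷ y) (ℕₚ.m≤n⇒m≤1+n κ≤)) m) ⟩
    ℤ.- S (λ x → sign n ℤ.* F n s (x ∷ y)) m      ≡⟨ cong ℤ.-_ (S-* (sign n) _ m) ⟩
    ℤ.- (sign n ℤ.* S (λ x → F n s (x ∷ y)) m)    ≡⟨ ℤₚ.neg-distribˡ-* (sign n) _ ⟩
    sign (suc n) ℤ.* S (λ x → F n s (x ∷ y)) m    ∎
    where
    open ≡-Reasoning
    m s′ : ℤ
    m = slack s y
    s′ = -[1+ suc κ ] ℤ.- s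
    y′ : List ℤ
    y′ = map reflect y

-- Backward differences and the coefficients of h*.

∇ : (ℤ → ℤ) → ℤ → ℤ
∇ f m = f m ℤ.- f (m ℤ.- 1ℤ)

∇^ : ℕ → (ℤ → ℤ) → ℤ → ℤ
∇^ zero    f = f
∇^ (suc N) f = ∇ (∇^ N f)

∇^-cong : ∀ N {f g} → (∀ m → f m ≡ g m) → ∀ m → ∇^ N f m ≡ ∇^ N g m
∇^-cong zero    e m = e m
∇^-cong (suc N) e m = cong₂ ℤ._-_ (∇^-cong N e m) (∇^-cong N e (m ℤ.- 1ℤ))

-- `∇^` adds its differences on the outside, `Poly` on the inside; this reconciles them.
∇^-∇ : ∀ N f m → ∇^ N (∇ f) m ≡ ∇^ (suc N) f m
∇^-∇ zero    f m = refl
∇^-∇ (suc N) f m = cong₂ ℤ._-_ (∇^-∇ N f m) (∇^-∇ N f (m ℤ.- 1ℤ))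

∇^-+* : ∀ N f c g m →
  ∇^ N (λ x → f x ℤ.+ c ℤ.* g x) m ≡ ∇^ N f m ℤ.+ c ℤ.* ∇^ N g m
∇^-+* zero    f c g m = refl
∇^-+* (suc N) f c g m rewrite ∇^-+* N f c g m | ∇^-+* N f c g (m ℤ.- 1ℤ) =
  lemma (∇^ N f m) _ c (∇^ N g m) _
  where
  lemma : ∀ a b c d e → (a ℤ.+ c ℤ.* d) ℤ.- (b ℤ.+ c ℤ.* e) ≡ (a ℤ.- b) ℤ.+ c ℤ.* (d ℤ.- e)
  lemma = solve-∀

-- Reflection makes each backward difference a negated forward one, which is a backward difference
-- one step further on; hence the sign and the shift by N.
∇^-reflect : ∀ N c f m →
  ∇^ N (λ x → f (c ℤ.- x)) m ≡ sign N ℤ.* ∇^ N f (c ℤ.+ (+ N) ℤ.- m)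
∇^-reflect zero    c f m = trans (cong (λ z → f (z ℤ.- m)) (sym (ℤₚ.+-identityʳ c))) (sym (ℤₚ.*-identityˡ _))
∇^-reflect (suc N) c f m = trans
  (cong₂ ℤ._-_
    (trans (∇^-reflect N c f m) (cong (λ z → sign N ℤ.* ∇^ N f z) (arg₁ c (+ N) m)))
    (trans (∇^-reflect N c f (m ℤ.- 1ℤ)) (cong (λ z → sign N ℤ.* ∇^ N f z) (arg₂ c (+ N) m))))
  (lemma (sign N) (∇^ N f (c ℤ.+ (+ suc N) ℤ.- m ℤ.- 1ℤ)) _)
  where
  arg₁ : ∀ c N m → c ℤ.+ N ℤ.- m ≡ c ℤ.+ (1ℤ ℤ.+ N) ℤ.- m ℤ.- 1ℤ
  arg₁ = solve-∀
  arg₂ : ∀ c N m → c ℤ.+ N ℤ.- (m ℤ.- 1ℤ) ≡ c ℤ.+ (1ℤ ℤ.+ N) ℤ.- m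
  arg₂ = solve-∀
  lemma : ∀ s a b → s ℤ.* a ℤ.- s ℤ.* b ≡ ℤ.- s ℤ.* (b ℤ.- a)
  lemma = solve-∀

Poly⇒∇^≡0 : ∀ d {f} → Poly d f → ∀ y m → ∇^ d (λ t → f t y) m ≡ 0ℤ
Poly⇒∇^≡0 zero    p y m = p m y
Poly⇒∇^≡0 (suc d) {f} p y m =
  -- In the direction -1, `[]` the operator `diff` is `∇` in t, with y unchanged.
  trans (sym (∇^-∇ d (λ t → f t y) m)) (Poly⇒∇^≡0 d (p -1ℤ []) y m)

ext : (ℕ → ℤ) → ℤ → ℤ
ext e (+ h)    = e h
ext e -[1+ _ ] = 0ℤ

-- Backward differences look only to the left, where the extension is 0.
∇^-ext-neg : ∀ N e j → ∇^ N (ext e) -[1+ j ] ≡ 0ℤ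
∇^-ext-neg zero    e j = refl
-- The index `suc (j ℕ.+ 0)` is what subtracting 1 from `-[1+ j ]` computes to.
∇^-ext-neg (suc N) e j = cong₂ ℤ._-_ (∇^-ext-neg N e j) (∇^-ext-neg N e (suc (j ℕ.+ 0)))

-- The coefficient of z^h in (1-z)^N · Σ e(t) z^t.
binomialSum : ℕ → (ℕ → ℤ) → ℕ → ℤ
binomialSum N e h = Sum (suc h) (λ j → sign j ℤ.* (+ (N C j)) ℤ.* e (h ∸ j))

-- One more factor 1-z; on coefficients this is Pascal's rule.
binomialSum-suc : ∀ N e h →
  binomialSum (suc N) e (suc h) ≡ binomialSum N e (suc h) ℤ.- binomialSum N e h
binomialSum-suc N e h = begin
  a ℤ.+ Sum (suc h) (λ j → ℤ.- sign j ℤ.* (+ (suc N C suc j)) ℤ.* e (h ∸ j))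
    ≡⟨ cong (ℤ._+_ a) (Sum-cong (suc h) pascal) ⟩
  a ℤ.+ Sum (suc h) (λ j → u j ℤ.+ -1ℤ ℤ.* v j)
    ≡⟨ cong (ℤ._+_ a) (trans (Sum-+ (suc h) u (λ j → -1ℤ ℤ.* v j)) (cong (ℤ._+_ (Sum (suc h) u)) (Sum-* (suc h) -1ℤ v))) ⟩
  a ℤ.+ (Sum (suc h) u ℤ.+ -1ℤ ℤ.* Sum (suc h) v)
    ≡⟨ lemma a (Sum (suc h) u) (Sum (suc h) v) ⟩
  a ℤ.+ Sum (suc h) u ℤ.- Sum (suc h) v ∎
  where
  open ≡-Reasoning
  a : ℤ
  a = 1ℤ ℤ.* 1ℤ ℤ.* e (suc h)
  u v : ℕ → ℤ
  u j = ℤ.- sign j ℤ.* (+ (N C suc j)) ℤ.* e (h ∸ j)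
  v j = sign j ℤ.* (+ (N C j)) ℤ.* e (h ∸ j)
  lemma : ∀ a b c → a ℤ.+ (b ℤ.+ -1ℤ ℤ.* c) ≡ a ℤ.+ b ℤ.- c
  lemma = solve-∀
  lemma′ : ∀ s c c′ e → ℤ.- s ℤ.* (c ℤ.+ c′) ℤ.* e ≡ ℤ.- s ℤ.* c′ ℤ.* e ℤ.+ -1ℤ ℤ.* (s ℤ.* c ℤ.* e)
  lemma′ = solve-∀
  pascal : ∀ j → ℤ.- sign j ℤ.* (+ (suc N C suc j)) ℤ.* e (h ∸ j) ≡ u j ℤ.+ -1ℤ ℤ.* v j
  pascal j rewrite sym (nCk+nC[k+1]≡[n+1]C[k+1] N j) = lemma′ (sign j) (+ (N C j)) (+ (N C suc j)) (e (h ∸ j))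

binomialSum-0 : ∀ e h → binomialSum 0 e h ≡ e h
binomialSum-0 e h = trans
  (cong₂ ℤ._+_ (ℤₚ.*-identityˡ (e h)) (Sum-zero h (λ j →
    cong (λ z → z ℤ.* e (h ∸ suc j))
      (trans (cong (λ c → sign (suc j) ℤ.* (+ c)) (k>n⇒nCk≡0 {n = 0} {k = suc j} (s≤s z≤n))) (ℤₚ.*-zeroʳ (sign (suc j)))))))
  (ℤₚ.+-identityʳ (e h))

-- Multiplying a generating function by 1-z takes the backward difference of its coefficients, the
-- one at -1 being 0.
∇^-ext : ∀ N e h → ∇^ N (ext e) (+ h) ≡ binomialSum N e h
∇^-ext zero    e h       = sym (binomialSum-0 e h)
∇^-ext (suc N) e zero    rewrite ∇^-ext N e 0 | ∇^-ext-neg N e 0 = ℤₚ.+-identityʳ _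
∇^-ext (suc N) e (suc h) =
  trans (cong₂ ℤ._-_ (∇^-ext N e (suc h)) (∇^-ext N e h)) (sym (binomialSum-suc N e h))

foldr-applyUpTo : ∀ (f : ℕ → ℤ) g n → foldr ℤ._+_ 0ℤ (map f (applyUpTo g n)) ≡ Sum n (λ i → f (g i))
foldr-applyUpTo f g zero    = refl
foldr-applyUpTo f g (suc n) = cong (ℤ._+_ (f (g 0))) (foldr-applyUpTo f (λ i → g (suc i)) n)

hstar-∇^ : ∀ k n h → hstar k n h ≡ ∇^ (suc n) (ext (λ t → + ehrhart k n t)) (+ h)
hstar-∇^ k n h = trans (foldr-applyUpTo (λ j → sign j ℤ.* (+ (suc n C j)) ℤ.* (+ ehrhart k n (h ∸ j))) (λ i → i) (suc h))
  (sym (∇^-ext (suc n) (λ t → + ehrhart k n t) h))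

-- Sums over boxes and counting of lattice points.

sumBox : ℕ → ℕ → (List ℕ → ℤ) → ℤ
sumBox B zero    g = g []
sumBox B (suc n) g = Sum (suc B) (λ a → sumBox B n (λ x → g (a ∷ x)))

sumBox-cong : ∀ B n {g h} → (∀ x → length x ≡ n → g x ≡ h x) → sumBox B n g ≡ sumBox B n h
sumBox-cong B zero    e = e [] refl
sumBox-cong B (suc n) e =
  Sum-cong (suc B) (λ a → sumBox-cong B n (λ x l → e (a ∷ x) (cong suc l)))

sumBox-zero : ∀ B n {g} → (∀ x → length x ≡ n → g x ≡ 0ℤ) → sumBox B n g ≡ 0ℤ
sumBox-zero B zero    e = e [] refl
sumBox-zero B (suc n) e =
  Sum-zero (suc B) (λ a → sumBox-zero B n (λ x l → e (a ∷ x) (cong suc l)))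

-- `F` chooses first the entry next to y, which is the last coordinate, whereas `sumBox` peels off
-- the first; exchanging sums reconciles the two orders.
sumBox-snoc : ∀ B n g →
  sumBox B (suc n) g ≡ Sum (suc B) (λ a → sumBox B n (λ x → g (x ∷ʳ a)))
sumBox-snoc B zero    g = refl
sumBox-snoc B (suc n) g = trans
  (Sum-cong (suc B) (λ b → sumBox-snoc B n (λ x → g (b ∷ x))))
  (Sum-swap (suc B) (suc B) (λ b a → sumBox B n (λ x → g (b ∷ (x ∷ʳ a)))))

sumBox-shrink : ∀ {t B} n {g} → t ≤ B → (∀ x → ¬ All (_≤ t) x → g x ≡ 0ℤ) →
  sumBox B n g ≡ sumBox t n g
sumBox-shrink zero    t≤B z = refl
sumBox-shrink {t} {B} (suc n) t≤B z = Sum-truncate (s≤s t≤B)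
  (λ a _ → sumBox-shrink n t≤B (λ x ¬p → z (a ∷ x) (λ { (_ ∷ p) → ¬p p })))
  (λ a t<a → sumBox-zero B n (λ x _ → z (a ∷ x) (λ { (a≤t ∷ _) → ℕₚ.<⇒≱ t<a a≤t })))

sumBox-0 : ∀ n g → sumBox 0 n g ≡ g (replicate n 0)
sumBox-0 zero    g = refl
sumBox-0 (suc n) g = trans (ℤₚ.+-identityʳ _) (sumBox-0 n (λ x → g (0 ∷ x)))

χ : ∀ {A : Set} → Dec A → ℤ
χ (yes _) = 1ℤ
χ (no  _) = 0ℤ

χ-cong : ∀ {A B : Set} (a? : Dec A) (b? : Dec B) → (A → B) → (B → A) → χ a? ≡ χ b?
χ-cong (yes a) (yes b) f g = refl
χ-cong (yes a) (no ¬b) f g = contradiction (f a) ¬b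
χ-cong (no ¬a) (yes b) f g = contradiction (g b) ¬a
χ-cong (no ¬a) (no ¬b) f g = refl

χ-yes : ∀ {A : Set} (a? : Dec A) → A → χ a? ≡ 1ℤ
χ-yes (yes _) a = refl
χ-yes (no ¬a) a = contradiction a ¬a

χ-no : ∀ {A : Set} (a? : Dec A) → ¬ A → χ a? ≡ 0ℤ
χ-no (yes a) ¬a = contradiction a ¬a
χ-no (no _)  ¬a = refl

count : ∀ {P : List ℕ → Set} → Decidable P → List (List ℕ) → ℤ
count P? xs = + length (filter P? xs)

count-++ : ∀ {P : List ℕ → Set} (P? : Decidable P) xs ys →
  count P? (xs ++ ys) ≡ count P? xs ℤ.+ count P? ys
count-++ P? []       ys = refl
count-++ P? (x ∷ xs) ys with P? x
... | yes _ = cong (ℤ._+_ 1ℤ) (count-++ P? xs ys)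
... | no  _ = count-++ P? xs ys

count-map : ∀ {P : List ℕ → Set} (P? : Decidable P) f xs →
  count P? (map f xs) ≡ count (λ x → P? (f x)) xs
count-map P? f []       = refl
count-map P? f (x ∷ xs) with P? (f x)
... | yes _ = cong (ℤ._+_ 1ℤ) (count-map P? f xs)
... | no  _ = count-map P? f xs

count-concatMap : ∀ {P : List ℕ → Set} (P? : Decidable P) (f : ℕ → List (List ℕ)) g n →
  count P? (concatMap f (applyUpTo g n)) ≡ Sum n (λ i → count P? (f (g i)))
count-concatMap P? f g zero    = refl
count-concatMap P? f g (suc n) = trans
  (count-++ P? (f (g 0)) (concatMap f (applyUpTo (λ i → g (suc i)) n)))
  (cong (ℤ._+_ (count P? (f (g 0)))) (count-concatMap P? f (λ i → g (suc i)) n))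

count-box : ∀ {P : List ℕ → Set} (P? : Decidable P) t n →
  count P? (box t n) ≡ sumBox t n (λ x → χ (P? x))
count-box P? t zero with P? []
... | yes _ = refl
... | no  _ = refl
count-box P? t (suc n) = trans
  (count-concatMap P? (λ a → map (a ∷_) (box t n)) (λ i → i) (suc t))
  (Sum-cong (suc t) (λ a → trans (count-map P? (a ∷_) (box t n)) (count-box (λ x → P? (a ∷ x)) t n)))

-- Inequalities for prefix sums.

+-∸ : ∀ {d h} → h ≤ d → (+ d) ℤ.- (+ h) ≡ + (d ∸ h)
+-∸ {d} {h} h≤d = trans (ℤₚ.m-n≡m⊖n d h) (ℤₚ.⊖-≥ h≤d)

-- Reduces the transfer of an inequality to a ring identity.
≤-shift : ∀ {i j i′ j′} → j ℤ.- i ≡ j′ ℤ.- i′ → i ℤ.≤ j → i′ ℤ.≤ j′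
≤-shift e p = ℤₚ.0≤i-j⇒j≤i (subst (0ℤ ℤ.≤_) e (ℤₚ.i≤j⇒0≤j-i p))

-- The bound -1 admits the naturals and also -1, the reflection of a zero boundary entry.
GeqNeg1 : ℤ → Set
GeqNeg1 b = 0ℤ ℤ.≤ 1ℤ ℤ.+ b

prefixSum-[] : ∀ κ → prefixSum κ [] ≡ 0ℤ
prefixSum-[] zero    = refl
prefixSum-[] (suc κ) = refl

prefixSum-lower : ∀ κ {y} → All GeqNeg1 y → 0ℤ ℤ.≤ (+ κ) ℤ.+ prefixSum κ y
prefixSum-lower zero    _            = +≤+ z≤n
prefixSum-lower (suc κ) []           = +≤+ z≤n
prefixSum-lower (suc κ) {b ∷ y} (p ∷ ps) =
  subst (0ℤ ℤ.≤_) (lemma b (+ κ) (prefixSum κ y)) (ℤₚ.+-mono-≤ p (prefixSum-lower κ ps))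
  where
  lemma : ∀ b κ q → (1ℤ ℤ.+ b) ℤ.+ (κ ℤ.+ q) ≡ (1ℤ ℤ.+ κ) ℤ.+ (b ℤ.+ q)
  lemma = solve-∀

-- Prepending x pushes one entry out of the prefix, and that entry is at least -1. This keeps
-- `slack` nonnegative when a fitting entry is prepended.
prefixSum-∷ : ∀ κ x {y} → GeqNeg1 x → All GeqNeg1 y →
  prefixSum κ (x ∷ y) ℤ.≤ 1ℤ ℤ.+ x ℤ.+ prefixSum κ y
prefixSum-∷ zero    x p ps = subst (0ℤ ℤ.≤_) (sym (ℤₚ.+-identityʳ _)) p
prefixSum-∷ (suc κ) x p [] rewrite prefixSum-[] κ = ≤-shift (lemma x) (+≤+ z≤n)
  where
  lemma : ∀ x → 1ℤ ℤ.- 0ℤ ≡ 1ℤ ℤ.+ x ℤ.+ 0ℤ ℤ.- (x ℤ.+ 0ℤ)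
  lemma = solve-∀
prefixSum-∷ (suc κ) x {b ∷ y} p (pb ∷ ps) =
  ≤-shift (lemma x b (prefixSum κ y) (prefixSum κ (b ∷ y))) (prefixSum-∷ κ b pb ps)
  where
  lemma : ∀ x b q r → 1ℤ ℤ.+ b ℤ.+ q ℤ.- r ≡ 1ℤ ℤ.+ x ℤ.+ (b ℤ.+ q) ℤ.- (x ℤ.+ r)
  lemma = solve-∀

prefixSum-++-full : ∀ κ x y → κ ≤ length x → prefixSum κ (map +_ x ++ y) ≡ + sum (take κ x)
prefixSum-++-full zero    x       y _        = refl
prefixSum-++-full (suc κ) (a ∷ x) y (s≤s κ≤) = cong (ℤ._+_ (+ a)) (prefixSum-++-full κ x y κ≤)

prefixSum-++-≤ : ∀ κ x {y} → All (ℤ._≤ 0ℤ) y → prefixSum κ (map +_ x ++ y) ℤ.≤ + sum (take κ x)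
prefixSum-++-≤ zero    x       ps       = +≤+ z≤n
prefixSum-++-≤ (suc κ) []      []       = +≤+ z≤n
prefixSum-++-≤ (suc κ) []      (p ∷ ps) =
  ℤₚ.+-mono-≤ p (ℤₚ.≤-trans (prefixSum-++-≤ κ [] ps) (ℤₚ.≤-reflexive (cong (λ z → + sum z) (take-all κ [] z≤n))))
prefixSum-++-≤ (suc κ) (a ∷ x) ps       = ℤₚ.+-monoʳ-≤ (+ a) (prefixSum-++-≤ κ x ps)

prefixSum-replicate : ∀ κ c → prefixSum κ (replicate κ c) ≡ (+ κ) ℤ.* c
prefixSum-replicate zero    c = sym (ℤₚ.*-zeroˡ c)
prefixSum-replicate (suc κ) c rewrite prefixSum-replicate κ c = lemma c (+ κ)
  where
  lemma : ∀ c κ → c ℤ.+ κ ℤ.* c ≡ (1ℤ ℤ.+ κ) ℤ.* c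
  lemma = solve-∀

map-∷ʳ-++ : ∀ x a (y : List ℤ) → map +_ (x ∷ʳ a) ++ y ≡ map +_ x ++ (+ a ∷ y)
map-∷ʳ-++ []      a y = refl
map-∷ʳ-++ (b ∷ x) a y = cong (+ b ∷_) (map-∷ʳ-++ x a y)

sum-take-drop≤sum : ∀ j i x → sum (take j (drop i x)) ≤ sum x
sum-take-drop≤sum zero    i       x       = z≤n
sum-take-drop≤sum (suc j) zero    []      = z≤n
sum-take-drop≤sum (suc j) zero    (a ∷ x) = ℕₚ.+-monoʳ-≤ a (sum-take-drop≤sum j 0 x)
sum-take-drop≤sum (suc j) (suc i) []      = z≤n
sum-take-drop≤sum (suc j) (suc i) (a ∷ x) =
  ℕₚ.≤-trans (sum-take-drop≤sum (suc j) i x) (ℕₚ.m≤n+m (sum x) a)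

-- Window conditions and the points counted by `F`.

module _ (κ : ℕ) where

  -- Every window of 1 + κ consecutive entries of x ++ y that starts inside x
  -- (cut short where the list ends) has sum at most s.
  Windows : ℤ → List ℤ → List ℕ → Set
  Windows s y []      = ⊤
  Windows s y (a ∷ x) = ((+ a) ℤ.+ prefixSum κ (map +_ x ++ y) ℤ.≤ s) × Windows s y x

  windows? : ∀ s y x → Dec (Windows s y x)
  windows? s y []      = yes tt
  windows? s y (a ∷ x) = ((+ a) ℤ.+ prefixSum κ (map +_ x ++ y) ℤ.≤? s) ×-dec windows? s y x

  windows-∷ʳ⁺ : ∀ s y x a → (+ a) ℤ.+ prefixSum κ y ℤ.≤ s →
    Windows s (+ a ∷ y) x → Windows s y (x ∷ʳ a)
  windows-∷ʳ⁺ s y []      a p w       = p , tt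
  windows-∷ʳ⁺ s y (b ∷ x) a p (q , w) rewrite map-∷ʳ-++ x a y = q , windows-∷ʳ⁺ s y x a p w

  windows-∷ʳ⁻ : ∀ s y x a → Windows s y (x ∷ʳ a) →
    ((+ a) ℤ.+ prefixSum κ y ℤ.≤ s) × Windows s (+ a ∷ y) x
  windows-∷ʳ⁻ s y []      a (p , _) = p , tt
  windows-∷ʳ⁻ s y (b ∷ x) a (q , w) rewrite map-∷ʳ-++ x a y with windows-∷ʳ⁻ s y x a w
  ... | p , w′ = p , q , w′

  -- Nonnegative slack makes `S` an ordinary sum, and `prefixSum-∷` preserves this along the
  -- induction. Since prefix sums are at least -κ, every entry is at most s + κ and fits in the box.
  F-count : ∀ n s y B → All GeqNeg1 y → 0ℤ ℤ.≤ slack κ s y → s ℤ.+ (+ κ) ℤ.≤ + B →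
    F κ n s y ≡ sumBox B n (λ x → χ (windows? s y x))
  F-count zero    s y B ay 0≤m s≤B = refl
  F-count (suc n) s y B ay 0≤m s≤B = begin
    S f (slack κ s y)       ≡⟨ cong (S f) (sym +p≡m) ⟩
    Sum p (λ a → f (+ a))   ≡⟨ sym (Sum-truncate p≤1+B on off) ⟩
    Sum (suc B) (λ a → sumBox B n (λ x → χ (windows? s y (x ∷ʳ a))))
                            ≡⟨ sym (sumBox-snoc B n (λ x → χ (windows? s y x))) ⟩
    sumBox B (suc n) (λ x → χ (windows? s y x)) ∎
    where
    open ≡-Reasoning
    f : ℤ → ℤ
    f x = F κ n s (x ∷ y)
    q : ℤ
    q = prefixSum κ y
    p : ℕ
    p = ℤ.∣ slack κ s y ∣
    +p≡m : + p ≡ slack κ s y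
    +p≡m = ℤₚ.0≤i⇒+∣i∣≡i 0≤m

    lemma₁ : ∀ s a q → (1ℤ ℤ.+ s ℤ.- q) ℤ.- (1ℤ ℤ.+ a) ≡ s ℤ.- (a ℤ.+ q)
    lemma₁ = solve-∀
    lemma₂ : ∀ s a q r → (s ℤ.- (a ℤ.+ q)) ℤ.+ ((1ℤ ℤ.+ a ℤ.+ q) ℤ.- r) ≡ 1ℤ ℤ.+ s ℤ.- r
    lemma₂ = solve-∀
    lemma₃ : ∀ s b κ q → (b ℤ.- (s ℤ.+ κ)) ℤ.+ (κ ℤ.+ q) ≡ (1ℤ ℤ.+ b) ℤ.- (1ℤ ℤ.+ s ℤ.- q)
    lemma₃ = solve-∀

    fits : ∀ a → a < p → (+ a) ℤ.+ q ℤ.≤ s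
    fits a a<p = ≤-shift (lemma₁ s (+ a) q) (subst ((+ suc a) ℤ.≤_) +p≡m (+≤+ a<p))

    fits⁻ : ∀ a → (+ a) ℤ.+ q ℤ.≤ s → a < p
    fits⁻ a le = ℤₚ.drop‿+≤+ (subst ((+ suc a) ℤ.≤_) (sym +p≡m) (≤-shift (sym (lemma₁ s (+ a) q)) le))

    p≤1+B : p ≤ suc B
    p≤1+B = ℤₚ.drop‿+≤+ (subst (ℤ._≤ (+ suc B)) (sym +p≡m)
      (ℤₚ.0≤i-j⇒j≤i (subst (0ℤ ℤ.≤_) (lemma₃ s (+ B) (+ κ) q)
        (ℤₚ.+-mono-≤ (ℤₚ.i≤j⇒0≤j-i s≤B) (prefixSum-lower κ ay)))))

    0≤m′ : ∀ a → a < p → 0ℤ ℤ.≤ slack κ s (+ a ∷ y)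
    0≤m′ a a<p = subst (0ℤ ℤ.≤_) (lemma₂ s (+ a) q (prefixSum κ (+ a ∷ y)))
      (ℤₚ.+-mono-≤ (ℤₚ.i≤j⇒0≤j-i (fits a a<p)) (ℤₚ.i≤j⇒0≤j-i (prefixSum-∷ κ (+ a) (+≤+ z≤n) ay)))

    on : ∀ a → a < p → sumBox B n (λ x → χ (windows? s y (x ∷ʳ a))) ≡ f (+ a)
    on a a<p = trans
      (sumBox-cong B n (λ x _ → χ-cong (windows? s y (x ∷ʳ a)) (windows? s (+ a ∷ y) x)
        (λ w → proj₂ (windows-∷ʳ⁻ s y x a w)) (windows-∷ʳ⁺ s y x a (fits a a<p))))
      (sym (F-count n s (+ a ∷ y) B (+≤+ z≤n ∷ ay) (0≤m′ a a<p) s≤B))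

    off : ∀ a → p ≤ a → sumBox B n (λ x → χ (windows? s y (x ∷ʳ a))) ≡ 0ℤ
    off a p≤a = sumBox-zero B n (λ x _ → χ-no (windows? s y (x ∷ʳ a))
      (λ w → ℕₚ.<⇒≱ (fits⁻ a (proj₁ (windows-∷ʳ⁻ s y x a w))) p≤a))

  windows⇒full : ∀ s y x → Windows s y x → ∀ i → i ℕ.+ suc κ ≤ length x →
    + sum (take (suc κ) (drop i x)) ℤ.≤ s
  windows⇒full s y (a ∷ x) (p , w) zero    (s≤s κ≤) =
    subst (λ z → (+ a) ℤ.+ z ℤ.≤ s) (prefixSum-++-full κ x y κ≤) p
  windows⇒full s y (a ∷ x) (p , w) (suc i) (s≤s i≤) = windows⇒full s y x w i i≤

  -- A suffix shorter than 1 + κ lies inside the last full window.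
  full⇒all : ∀ t x → suc κ ≤ length x →
    (∀ i → i ℕ.+ suc κ ≤ length x → sum (take (suc κ) (drop i x)) ≤ t) →
    ∀ i → sum (take (suc κ) (drop i x)) ≤ t
  full⇒all t x       k≤ full zero = full 0 k≤
  full⇒all t (a ∷ x) (s≤s κ≤) full (suc i) with suc κ ℕ.≤? length x
  ... | yes k≤ = full⇒all t x k≤ (λ j j≤ → full (suc j) (s≤s j≤)) i
  ... | no  k≰ = begin
    sum (take (suc κ) (drop i x)) ≤⟨ sum-take-drop≤sum (suc κ) i x ⟩
    sum x                         ≡⟨ cong sum (take-all κ x (ℕₚ.≤-pred (ℕₚ.≰⇒> k≰))) ⟨
    sum (take κ x)                ≤⟨ ℕₚ.m≤n+m _ a ⟩
    a ℕ.+ sum (take κ x)          ≤⟨ full 0 (s≤s κ≤) ⟩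
    t                             ∎
    where open ℕₚ.≤-Reasoning

  -- A window running into y gains only nonpositive entries beyond its part in x.
  all⇒windows : ∀ t y x → All (ℤ._≤ 0ℤ) y →
    (∀ i → sum (take (suc κ) (drop i x)) ≤ t) → Windows (+ t) y x
  all⇒windows t y []      ps all = tt
  all⇒windows t y (a ∷ x) ps all =
    ℤₚ.≤-trans (ℤₚ.+-monoʳ-≤ (+ a) (prefixSum-++-≤ κ x ps)) (+≤+ (all 0)) ,
    all⇒windows t y x ps (λ i → all (suc i))

  windows⇒inDilate : ∀ t y x → suc κ ≤ length x → Windows (+ t) y x →
    InDilate (suc κ) (length x) t x
  windows⇒inDilate t y x k≤ w = Allₚ.applyUpTo⁺₁ (λ i → i) (suc (length x ∸ suc κ))
    (λ {i} i< → ℤₚ.drop‿+≤+ (windows⇒full (+ t) y x w i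
      (ℕₚ.m≤o∸n⇒m+n≤o i k≤ (ℕₚ.≤-pred i<))))

  inDilate⇒windows : ∀ t y x → All (ℤ._≤ 0ℤ) y → suc κ ≤ length x →
    InDilate (suc κ) (length x) t x → Windows (+ t) y x
  inDilate⇒windows t y x ps k≤ d = all⇒windows t y x ps (full⇒all t x k≤
    (λ i i≤ → Allₚ.applyUpTo⁻ (λ i → i) (suc (length x ∸ suc κ)) d
      (s≤s (ℕₚ.m+n≤o⇒m≤o∸n i i≤))))

  windows-[]⇒bounded : ∀ t x → Windows (+ t) [] x → All (_≤ t) x
  windows-[]⇒bounded t []      w       = []
  windows-[]⇒bounded t (a ∷ x) (p , w) =
    ℤₚ.drop‿+≤+ (ℤₚ.≤-trans (≤-shift (lemma (+ a) q) (nonneg κ x)) p) ∷ windows-[]⇒bounded t x w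
    where
    q : ℤ
    q = prefixSum κ (map +_ x ++ [])
    lemma : ∀ a q → q ℤ.- 0ℤ ≡ a ℤ.+ q ℤ.- a
    lemma = solve-∀
    nonneg : ∀ j z → 0ℤ ℤ.≤ prefixSum j (map +_ z ++ [])
    nonneg zero    z       = +≤+ z≤n
    nonneg (suc j) []      = +≤+ z≤n
    nonneg (suc j) (b ∷ z) = ℤₚ.+-mono-≤ (+≤+ {0} {b} z≤n) (nonneg j z)

  -- Ehrhart reciprocity and the symmetry of h*.

  ehrhartℤ : ℕ → ℤ → ℤ
  ehrhartℤ n = ext (λ t → + ehrhart (suc κ) n t)

  χ-windows : ∀ n t y → suc κ ≤ n → All (ℤ._≤ 0ℤ) y → ∀ x → length x ≡ n →
    χ (windows? (+ t) y x) ≡ χ (inDilate? (suc κ) n t x)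
  χ-windows n t y k≤n ps x refl = χ-cong (windows? (+ t) y x) (inDilate? (suc κ) n t x)
    (windows⇒inDilate t y x k≤n) (inDilate⇒windows t y x ps k≤n)

  -- For s ≥ 0 a nonpositive boundary adds no condition to those of the full windows in x. For s < 0
  -- the first full window, whose sum is a natural number, excludes every x.
  F-ehrhart : ∀ n s y → suc κ ≤ n → All GeqNeg1 y → All (ℤ._≤ 0ℤ) y →
    0ℤ ℤ.≤ slack κ s y → F κ n s y ≡ ehrhartℤ n s
  F-ehrhart n -[1+ j ] y k≤n ay ps 0≤m = trans
    (F-count n -[1+ j ] y κ ay 0≤m (≤-shift (lemma -[1+ j ] (+ κ)) (-≤+ {j} {0})))
    (sumBox-zero κ n λ x l → χ-no (windows? -[1+ j ] y x)
      (λ w → absurd (windows⇒full -[1+ j ] y x w 0 (subst (suc κ ≤_) (sym l) k≤n))))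
    where
    lemma : ∀ s κ → 0ℤ ℤ.- s ≡ κ ℤ.- (s ℤ.+ κ)
    lemma = solve-∀
    absurd : ∀ {m} → ¬ ((+ m) ℤ.≤ -[1+ j ])
    absurd ()
  F-ehrhart n (+ t) y k≤n ay ps 0≤m = begin
    F κ n (+ t) y
      ≡⟨ F-count n (+ t) y (t ℕ.+ κ) ay 0≤m ℤₚ.≤-refl ⟩
    sumBox (t ℕ.+ κ) n (λ x → χ (windows? (+ t) y x))
      -- With the empty boundary each entry is visibly at most t, so the box can shrink.
      ≡⟨ sumBox-cong (t ℕ.+ κ) n (λ x l → trans (χ-windows n t y k≤n ps x l) (sym (χ-windows n t [] k≤n [] x l))) ⟩
    sumBox (t ℕ.+ κ) n (λ x → χ (windows? (+ t) [] x))
      ≡⟨ sumBox-shrink n (ℕₚ.m≤m+n t κ) (λ x ¬b → χ-no (windows? (+ t) [] x) (λ w → ¬b (windows-[]⇒bounded t x w))) ⟩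
    sumBox t n (λ x → χ (windows? (+ t) [] x))
      ≡⟨ sumBox-cong t n (χ-windows n t [] k≤n []) ⟩
    sumBox t n (λ x → χ (inDilate? (suc κ) n t x))
      ≡⟨ count-box (inDilate? (suc κ) n t) t n ⟨
    + ehrhart (suc κ) n t ∎
    where open ≡-Reasoning

  ehrhart-reciprocity : ∀ n → suc κ ≤ n → ∀ m → F κ n m (replicate κ 0ℤ) ≡
    ehrhartℤ n m ℤ.+ sign n ℤ.* ehrhartℤ n (-[1+ suc κ ] ℤ.- m)
  ehrhart-reciprocity n k≤n (+ h) = begin
    F κ n (+ h) (replicate κ 0ℤ)       ≡⟨ F-ehrhart n (+ h) _ k≤n (Allₚ.replicate⁺ κ (+≤+ z≤n)) (Allₚ.replicate⁺ κ (+≤+ z≤n)) 0≤m ⟩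
    ehrhartℤ n (+ h)                   ≡⟨ ℤₚ.+-identityʳ _ ⟨
    ehrhartℤ n (+ h) ℤ.+ 0ℤ            ≡⟨ cong (ℤ._+_ (ehrhartℤ n (+ h))) (trans (cong (sign n ℤ.*_) (vanish h)) (ℤₚ.*-zeroʳ (sign n))) ⟨
    ehrhartℤ n (+ h) ℤ.+ sign n ℤ.* ehrhartℤ n (-[1+ suc κ ] ℤ.- (+ h)) ∎
    where
    open ≡-Reasoning
    vanish : ∀ h → ehrhartℤ n (-[1+ suc κ ] ℤ.- (+ h)) ≡ 0ℤ
    vanish zero    = refl
    vanish (suc h) = refl
    0≤m : 0ℤ ℤ.≤ slack κ (+ h) (replicate κ 0ℤ)
    0≤m rewrite prefixSum-replicate κ 0ℤ | ℤₚ.*-zeroʳ (+ κ) = +≤+ z≤n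
  -- Reflection takes the boundary 0 to -1 and m to s = j - k, where the slack is exactly j.
  ehrhart-reciprocity n k≤n m@(-[1+ j ]) = begin
    F κ n m (replicate κ 0ℤ)
      ≡⟨ cong₂ (F κ n) (sym (involutive -[1+ suc κ ] m)) (sym (map-replicate reflect κ -1ℤ)) ⟩
    F κ n (-[1+ suc κ ] ℤ.- s) (map reflect (replicate κ -1ℤ))
      ≡⟨ F-reflect κ n s (replicate κ -1ℤ) (ℕₚ.≤-reflexive (sym (length-replicate κ))) ⟩
    sign n ℤ.* F κ n s (replicate κ -1ℤ)
      ≡⟨ cong (sign n ℤ.*_) (F-ehrhart n s _ k≤n (Allₚ.replicate⁺ κ (+≤+ z≤n)) (Allₚ.replicate⁺ κ -≤+) 0≤m) ⟩
    sign n ℤ.* ehrhartℤ n s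
      ≡⟨ ℤₚ.+-identityˡ _ ⟨
    0ℤ ℤ.+ sign n ℤ.* ehrhartℤ n s ∎
    where
    open ≡-Reasoning
    s : ℤ
    s = -[1+ suc κ ] ℤ.- m
    involutive : ∀ c m → c ℤ.- (c ℤ.- m) ≡ m
    involutive = solve-∀
    lemma : ∀ κ j → j ≡ 1ℤ ℤ.+ (ℤ.- (+ 2 ℤ.+ κ) ℤ.- ℤ.- (1ℤ ℤ.+ j)) ℤ.- κ ℤ.* -1ℤ
    lemma = solve-∀
    0≤m : 0ℤ ℤ.≤ slack κ s (replicate κ -1ℤ)
    0≤m rewrite prefixSum-replicate κ -1ℤ = subst (0ℤ ℤ.≤_) (lemma (+ κ) (+ j)) (+≤+ z≤n)

  hstarℤ : ℕ → ℤ → ℤ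
  hstarℤ n = ∇^ (suc n) (ehrhartℤ n)

  -- The (n+1)-st difference of `ehrhart-reciprocity`: the polynomial side vanishes, and
  -- `∇^-reflect` evaluates the reflected term. The chain reads this backwards.
  hstarℤ-symmetric : ∀ n → suc κ ≤ n → ∀ m → hstarℤ n m ≡ hstarℤ n ((+ (n ∸ suc κ)) ℤ.- m)
  hstarℤ-symmetric n k≤n m = ℤₚ.i-j≡0⇒i≡j _ _ (begin
    hstarℤ n m ℤ.- hstarℤ n ((+ (n ∸ suc κ)) ℤ.- m)
      ≡⟨ cong (ℤ._+_ (hstarℤ n m)) (signs (hstarℤ n ((+ (n ∸ suc κ)) ℤ.- m))) ⟩
    hstarℤ n m ℤ.+ sign n ℤ.* (sign (suc n) ℤ.* hstarℤ n ((+ (n ∸ suc κ)) ℤ.- m))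
      -- Here n - k = (-k-1) + (n+1): the centre of reciprocity plus the shift from n+1 differences.
      ≡⟨ cong (λ z → hstarℤ n m ℤ.+ sign n ℤ.* (sign (suc n) ℤ.* hstarℤ n (z ℤ.- m))) degree ⟩
    hstarℤ n m ℤ.+ sign n ℤ.* (sign (suc n) ℤ.* hstarℤ n (c ℤ.+ (+ suc n) ℤ.- m))
      ≡⟨ cong (λ z → hstarℤ n m ℤ.+ sign n ℤ.* z) (∇^-reflect (suc n) c (ehrhartℤ n) m) ⟨
    hstarℤ n m ℤ.+ sign n ℤ.* ∇^ (suc n) (λ x → ehrhartℤ n (c ℤ.- x)) m
      ≡⟨ ∇^-+* (suc n) (ehrhartℤ n) (sign n) (λ x → ehrhartℤ n (c ℤ.- x)) m ⟨
    ∇^ (suc n) (λ x → ehrhartℤ n x ℤ.+ sign n ℤ.* ehrhartℤ n (c ℤ.- x)) m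
      ≡⟨ ∇^-cong (suc n) (ehrhart-reciprocity n k≤n) m ⟨
    ∇^ (suc n) (λ x → F κ n x (replicate κ 0ℤ)) m
      ≡⟨ Poly⇒∇^≡0 (suc n) {F κ n} (Poly-F κ n) (replicate κ 0ℤ) m ⟩
    0ℤ ∎)
    where
    open ≡-Reasoning
    c : ℤ
    c = -[1+ suc κ ]
    sign² : ∀ n → sign n ℤ.* sign n ≡ 1ℤ
    sign² zero    = refl
    sign² (suc n) = trans (neg² (sign n)) (sign² n)
      where
      neg² : ∀ s → ℤ.- s ℤ.* ℤ.- s ≡ s ℤ.* s
      neg² = solve-∀
    signs : ∀ a → ℤ.- a ≡ sign n ℤ.* (sign (suc n) ℤ.* a)
    signs a = trans (cong ℤ.-_ (trans (sym (ℤₚ.*-identityˡ a)) (cong (ℤ._* a) (sym (sign² n)))))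
      (lemma (sign n) a)
      where
      lemma : ∀ s a → ℤ.- (s ℤ.* s ℤ.* a) ≡ s ℤ.* (ℤ.- s ℤ.* a)
      lemma = solve-∀
    degree : + (n ∸ suc κ) ≡ c ℤ.+ (+ suc n)
    degree = sym (ℤₚ.⊖-≥ (s≤s k≤n))

  ehrhart-0 : ∀ n → + ehrhart (suc κ) n 0 ≡ 1ℤ
  ehrhart-0 n = trans (count-box (inDilate? (suc κ) n 0) 0 n)
    (trans (sumBox-0 n (λ x → χ (inDilate? (suc κ) n 0 x)))
      (χ-yes (inDilate? (suc κ) n 0 (replicate n 0))
        (Allₚ.applyUpTo⁺₂ (λ i → i) (suc (n ∸ suc κ))
          (λ i → ℕₚ.≤-trans (sum-take-drop≤sum (suc κ) i (replicate n 0)) (ℕₚ.≤-reflexive (sum-zeros n))))))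
    where
    sum-zeros : ∀ n → sum (replicate n 0) ≡ 0
    sum-zeros zero    = refl
    sum-zeros (suc n) = sum-zeros n

  hstar-symmetric : ∀ n → suc κ ≤ n → ∀ h → h ≤ n ∸ suc κ →
    hstar (suc κ) n h ≡ hstar (suc κ) n (n ∸ suc κ ∸ h)
  hstar-symmetric n k≤n h h≤ = begin
    hstar (suc κ) n h                       ≡⟨ hstar-∇^ (suc κ) n h ⟩
    hstarℤ n (+ h)                          ≡⟨ hstarℤ-symmetric n k≤n (+ h) ⟩
    hstarℤ n ((+ (n ∸ suc κ)) ℤ.- (+ h))    ≡⟨ cong (hstarℤ n) (+-∸ h≤) ⟩
    hstarℤ n (+ (n ∸ suc κ ∸ h))            ≡⟨ hstar-∇^ (suc κ) n _ ⟨
    hstar (suc κ) n (n ∸ suc κ ∸ h)         ∎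
    where open ≡-Reasoning

  -- The mirrored index is negative, where the differences vanish.
  hstar-above : ∀ n → suc κ ≤ n → ∀ h → n ∸ suc κ < h → hstar (suc κ) n h ≡ 0ℤ
  hstar-above n k≤n h d<h = begin
    hstar (suc κ) n h                       ≡⟨ hstar-∇^ (suc κ) n h ⟩
    hstarℤ n (+ h)                          ≡⟨ hstarℤ-symmetric n k≤n (+ h) ⟩
    hstarℤ n ((+ (n ∸ suc κ)) ℤ.- (+ h))    ≡⟨ negative ((+ (n ∸ suc κ)) ℤ.- (+ h)) d-h<0 ⟩
    0ℤ                                      ∎
    where
    open ≡-Reasoning
    d-h<0 : (+ (n ∸ suc κ)) ℤ.- (+ h) ℤ.< 0ℤ
    d-h<0 = subst ((+ (n ∸ suc κ)) ℤ.- (+ h) ℤ.<_) (ℤₚ.+-inverseʳ (+ h)) (ℤₚ.+-monoˡ-< (ℤ.- (+ h)) (ℤ.+<+ d<h))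
    negative : ∀ m → m ℤ.< 0ℤ → hstarℤ n m ≡ 0ℤ
    negative -[1+ j ] _ = ∇^-ext-neg (suc n) _ j
    negative (+ _) (ℤ.+<+ ())

  -- The mirror image of the constant coefficient, which counts the origin alone. With `hstar-above`
  -- this makes the degree exactly n - k.
  hstar-top : ∀ n → suc κ ≤ n → hstar (suc κ) n (n ∸ suc κ) ≡ 1ℤ
  hstar-top n k≤n = begin
    hstar (suc κ) n (n ∸ suc κ)             ≡⟨ hstar-symmetric n k≤n 0 z≤n ⟨
    hstar (suc κ) n 0                       ≡⟨ lemma (+ ehrhart (suc κ) n 0) ⟩
    + ehrhart (suc κ) n 0                   ≡⟨ ehrhart-0 n ⟩
    1ℤ                                      ∎
    where
    open ≡-Reasoning
    lemma : ∀ a → 1ℤ ℤ.* 1ℤ ℤ.* a ℤ.+ 0ℤ ≡ a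
    lemma = solve-∀

theorem2p10 : (k n : ℕ) → 1 ≤ k → k ≤ n →
    (d : ℕ) → hstar k n d ≢ + 0 → ((h : ℕ) → d < h → hstar k n h ≡ + 0) →
    (h : ℕ) → h ≤ d → hstar k n h ≡ hstar k n (d ∸ h)
theorem2p10 (suc κ) n _ k≤n d top≢0 above h h≤d with ℕₚ.<-cmp d (n ∸ suc κ)
-- Only d = n - k is possible: a larger d has coefficient 0, and a smaller one leaves the
-- coefficient 1 at n - k above it.
... | tri≈ _ refl _ = hstar-symmetric κ n k≤n h h≤d
... | tri> _ _ d>   = contradiction (hstar-above κ n k≤n d d>) top≢0
... | tri< d< _ _   = contradiction (trans (sym (hstar-top κ n k≤n)) (above _ d<)) (λ ())
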